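{- Let $G$ be a bridgeless graph with $n$ vertices in which every block is a complete graph. Then \[\overrightarrow{\mathrm{diam}}(G) \leq \begin{cases} \left\lfloor \frac{3n}{4} \right\rfloor & \text{if } n \text{ is even},\\ \left\lfloor \frac{3(n+1)}{4} \right\rfloor & \text{if } n \text{ is odd}.\end{cases}\]
   Context: All graphs are finite and simple. A graph is bridgeless if it is connected and has no bridge (an edge whose removal disconnects the graph). A block of $G$ is a maximal connected subgraph of $G$ that has no cut vertex; a graph all of whose blocks are complete graphs is called a block graph (or clique tree). An orientation of $G$ assigns a direction to each edge; it is strong if the resulting digraph is strongly connected. The diameter of a strong digraph is the maximum over ordered pairs $(u,v)$ of the directed distance from $u$ to $v$. The oriented diameter $\overrightarrow{\mathrm{diam}}(G)$ is the minimum diameter over all strong orientations of $G$. -}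

module Defs where

open import Data.Nat using (ℕ; zero; suc; _+_; _*_; _≤_; _/_)
open import Data.Nat.Base using (_%_)
open import Data.Fin using (Fin)
open import Data.Product using (Σ; _×_; _,_; ∃-syntax)
open import Data.Sum using (_⊎_)
open import Data.Empty using (⊥)
open import Relation.Nullary using (¬_)
open import Relation.Binary.PropositionalEquality using (_≡_)

-- A finite simple graph on the vertex set Fin n: a symmetric irreflexive
-- adjacency relation (decidable, as for any finite graph).
record Graph (n : ℕ) : Set₁ where
  field
    Adj     : Fin n → Fin n → Set
    sym     : ∀ {u v} → Adj u v → Adj v u
    irrefl  : ∀ {u} → ¬ Adj u u
    dec     : ∀ u v → Adj u v ⊎ ¬ Adj u v
open Graph public

VSet : ℕ → Set₁
VSet n = Fin n → Set

data Walk {n : ℕ} (S : VSet n) (E : Fin n → Fin n → Set) :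
          Fin n → Fin n → ℕ → Set where
  here : ∀ {u} → S u → Walk S E u u zero
  step : ∀ {u w v k} → S u → E u w → Walk S E w v k → Walk S E u v (suc k)

Joined : {n : ℕ} → VSet n → (Fin n → Fin n → Set) → Fin n → Fin n → Set
Joined S E u v = ∃[ k ] Walk S E u v k

Everything : {n : ℕ} → VSet n
Everything _ = Data.Unit.⊤
  where import Data.Unit

Connected : {n : ℕ} → Graph n → Set
Connected G = ∀ u v → Joined Everything (Adj G) u v

AdjMinus : {n : ℕ} → Graph n → Fin n → Fin n → Fin n → Fin n → Set
AdjMinus G a b u v = Adj G u v × ¬ ((u ≡ a × v ≡ b) ⊎ (u ≡ b × v ≡ a))

IsBridge : {n : ℕ} → Graph n → Fin n → Fin n → Set
IsBridge G a b = Adj G a b × ¬ (∀ u v → Joined Everything (AdjMinus G a b) u v)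

Bridgeless : {n : ℕ} → Graph n → Set
Bridgeless G = Connected G × (∀ a b → ¬ IsBridge G a b)

ConnectedOn : {n : ℕ} → Graph n → VSet n → Set
ConnectedOn G S = (∃[ x ] S x) × (∀ u v → S u → S v → Joined S (Adj G) u v)

Minus : {n : ℕ} → VSet n → Fin n → VSet n
Minus S x u = S u × ¬ u ≡ x

Biconnected : {n : ℕ} → Graph n → VSet n → Set
Biconnected G S = ConnectedOn G S ×
  (∀ x → S x → ∀ u v → Minus S x u → Minus S x v → Joined (Minus S x) (Adj G) u v)

-- A block: a maximal vertex set inducing a connected subgraph without
-- cut vertex (blocks are induced subgraphs, so vertex sets suffice).
IsBlock : {n : ℕ} → Graph n → VSet n → Set₁
IsBlock {n} G S = Biconnected G S ×
  ((T : VSet n) → Biconnected G T → (∀ u → S u → T u) → ∀ u → T u → S u)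

Complete : {n : ℕ} → Graph n → VSet n → Set
Complete G S = ∀ u v → S u → S v → ¬ u ≡ v → Adj G u v

BlockGraph : {n : ℕ} → Graph n → Set₁
BlockGraph {n} G = (S : VSet n) → IsBlock G S → Complete G S

record Orientation {n : ℕ} (G : Graph n) : Set₁ where
  field
    Arc      : Fin n → Fin n → Set
    arc-edge : ∀ {u v} → Arc u v → Adj G u v
    total    : ∀ {u v} → Adj G u v → Arc u v ⊎ Arc v u
    antisym  : ∀ {u v} → Arc u v → ¬ Arc v u
open Orientation public

DistLe : {n : ℕ} {G : Graph n} → Orientation G → Fin n → Fin n → ℕ → Set
DistLe D u v k = ∃[ j ] (j ≤ k × Walk Everything (Arc D) u v j)

DiamLe : {n : ℕ} {G : Graph n} → Orientation G → ℕ → Set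
DiamLe D k = ∀ u v → DistLe D u v k

-- The oriented diameter of G is at most k: some strong orientation of G
-- has diameter at most k (equivalent to min over strong orientations ≤ k).
OrientedDiamLe : {n : ℕ} → Graph n → ℕ → Set₁
OrientedDiamLe G k = Σ (Orientation G) (λ D → DiamLe D k)

bound : ℕ → ℕ
bound n with n % 2
... | zero  = (3 * n) / 4
... | suc _ = (3 * (n + 1)) / 4

{-# OPTIONS --safe #-}

-- Let P be a geodesic of maximal length r, from ρ to σ. Rank the vertices by their
-- distance to P, the P-vertices of even index first and those of odd index second, and
-- orient each block as first → second → others → first, where first and second are its
-- two lowest-ranked vertices. Every edge at the first or second vertex of its block
-- can then be traversed in either direction in at most 2 steps, and the edges of P are
-- oriented alternately, so that m consecutive ones cost ⌈3m/2⌉ in either direction.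
-- Going from u to v along P, where u and v hang at depths t₁ and t₂ off P, takes k steps
-- with 2k ≤ 3r + t₁ + t₂ + 3, because maximality of P bounds t₁ and t₂ by the lengths of
-- the unused ends of P. On the other hand every edge lies in a triangle, so
-- n ≥ 2(r + t) + 1 for each depth t that occurs.
module Submission where

open import Defs
open import Data.Nat using (ℕ; zero; suc; _+_; _*_; _∸_; _≤_; _<_; z≤n; s≤s; ⌊_/2⌋; _<?_; _≤?_)
open import Data.Nat.Properties
open import Data.Fin using (Fin; zero; suc; toℕ)
import Data.Fin.Properties as Fin
open import Data.Fin.Subset using (Subset; _⊃_)
import Data.Fin.Subset as Subset
import Data.Fin.Subset.Properties as Subset
open import Data.Fin.Subset.Induction using (⊃-wellFounded)
open import Data.Vec using (tabulate)
open import Data.Vec.Properties using (lookup∘tabulate; lookup⇒[]=; []=⇒lookup)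
open import Data.Nat.DivMod using (_/_; _%_; m≡m%n+[m/n]*n; m%n<n; m*n/n≡m; /-monoˡ-≤)
open import Data.Nat.Tactic.RingSolver using (solve-∀)
open import Data.List using (List; []; _∷_; length; lookup; allFin)
open import Data.List.Extrema ≤-totalOrder using (argmax; f[xs]≤f[argmax])
open import Data.List.Relation.Unary.All using (All; []; _∷_)
import Data.List.Relation.Unary.All as All
open import Data.List.Relation.Unary.AllPairs using ([]; _∷_)
open import Data.List.Relation.Unary.Unique.Propositional using (Unique)
open import Data.List.Membership.Propositional using (_∈_; _∉_)
open import Data.List.Membership.Propositional.Properties using (∈-lookup; ∈-allFin)
open import Data.List.Relation.Unary.Any using (here; there)
open import Data.Product using (_×_; _,_; proj₁; proj₂; ∃-syntax)
open import Data.Sum using (_⊎_; inj₁; inj₂)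
import Data.Sum as Sum
open import Data.Empty using (⊥-elim)
open import Data.Unit using (tt)
open import Function using (_∘_; id)
open import Induction.WellFounded using (Acc; acc)
open import Relation.Nullary using (¬_; Dec; yes; no; does; contradiction)
open import Relation.Nullary.Decidable using (decidable-stable; ¬¬-excluded-middle; dec-true; _×-dec_; map′; ¬?)
open import Relation.Binary.Definitions using (tri<; tri≈; tri>)
open import Relation.Binary.PropositionalEquality using (_≡_; _≢_; refl; trans; cong; cong₂; subst; subst₂; module ≡-Reasoning) renaming (sym to ≡-sym)

private
  variable
    n j k : ℕ
    S T : VSet n
    E : Fin n → Fin n → Set
    u v w x y : Fin n

-- Walks

_++ʷ_ : Walk S E u v j → Walk S E v w k → Walk S E u w (j + k)
here _     ++ʷ q = q
step s e p ++ʷ q = step s e (p ++ʷ q)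

snocʷ : Walk S E u v k → E v w → S w → Walk S E u w (suc k)
snocʷ (here s)     e t = step s e (here t)
snocʷ (step s f p) e t = step s f (snocʷ p e t)

reverseʷ : (∀ {u v} → E u v → E v u) → Walk S E u v k → Walk S E v u k
reverseʷ _   (here s)     = here s
reverseʷ swap (step s e p) = snocʷ (reverseʷ swap p) (swap e) s

source∈ : Walk S E u v k → S u
source∈ (here s)     = s
source∈ (step s _ _) = s

mapʷ : (∀ x → S x → T x) → Walk S E u v k → Walk T E u v k
mapʷ S⊆T (here s)     = here (S⊆T _ s)
mapʷ S⊆T (step s e p) = step (S⊆T _ s) e (mapʷ S⊆T p)

joined-refl : S u → Joined S E u u
joined-refl s = _ , here s

joined-trans : Joined S E u v → Joined S E v w → Joined S E u w
joined-trans (_ , p) (_ , q) = _ , p ++ʷ q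

joined-cons : S u → E u v → Joined S E v w → Joined S E u w
joined-cons s e (_ , p) = _ , step s e p

joined-snoc : Joined S E u v → E v w → S w → Joined S E u w
joined-snoc (_ , p) e s = _ , snocʷ p e s

joined-map : (∀ x → S x → T x) → Joined S E u v → Joined T E u v
joined-map S⊆T (_ , p) = _ , mapʷ S⊆T p

-- Biconnected vertex sets of block graphs

-- Vertex sets are arbitrary predicates, so membership need not be decidable. By finiteness it may
-- be assumed decidable while a contradiction is being derived, which allows passing to `Subset`,
-- where strict inclusion is well-founded.
¬¬-∀Dec : (S : VSet n) → ¬ ¬ (∀ x → Dec (S x))
¬¬-∀Dec {zero}  S ¬d = ¬d λ ()
¬¬-∀Dec {suc n} S ¬d = ¬¬-excluded-middle λ d₀ → ¬¬-∀Dec (S ∘ suc) λ ds →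
  ¬d λ { zero → d₀ ; (suc x) → ds x }

fromDec : {S : VSet n} → (∀ x → Dec (S x)) → Subset n
fromDec S? = tabulate (does ∘ S?)

∈-fromDec⁺ : (S? : ∀ x → Dec (S x)) → S x → x Subset.∈ fromDec S?
∈-fromDec⁺ {x = x} S? s =
  lookup⇒[]= x _ (trans (lookup∘tabulate (does ∘ S?) x) (dec-true (S? x) s))

∈-fromDec⁻ : (S? : ∀ x → Dec (S x)) → x Subset.∈ fromDec S? → S x
∈-fromDec⁻ {x = x} S? x∈ with S? x | trans (≡-sym (lookup∘tabulate (does ∘ S?) x)) ([]=⇒lookup x∈)
... | yes s | _  = s
... | no  _ | ()

module _ {n : ℕ} (G : Graph n) where

  biconnected-resp : (∀ x → S x → T x) → (∀ x → T x → S x) →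
                     Biconnected G S → Biconnected G T
  biconnected-resp to from (((x , s) , conn) , robust) =
    ((x , to x s) , λ u v tu tv → joined-map to (conn u v (from u tu) (from v tv))) ,
    λ x tx u v (tu , u≢x) (tv , v≢x) →
      joined-map (λ y (sy , y≢x) → to y sy , y≢x)
        (robust x (from x tx) u v (from u tu , u≢x) (from v tv , v≢x))

  module _ (block : BlockGraph G) where

    -- A non-adjacent pair u, v in a biconnected set refutes itself: the set
    -- could be enlarged forever, since no block contains it.
    nonadjacent⇒¬biconnected : u ≢ v → ¬ Adj G u v → (s : Subset n) → Acc _⊃_ s →
                     u Subset.∈ s → v Subset.∈ s → ¬ Biconnected G (Subset._∈ s)
    nonadjacent⇒¬biconnected {u} {v} u≢v u≁v s (acc rec) u∈s v∈s bic =
      u≁v (block (Subset._∈ s) (bic , maximal) u v u∈s v∈s u≢v)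
      where
      maximal : (T : VSet n) → Biconnected G T → (∀ x → x Subset.∈ s → T x) →
                ∀ x → T x → x Subset.∈ s
      maximal T bicT s⊆T x Tx = decidable-stable (x Subset.∈? s) λ x∉s →
        ¬¬-∀Dec T λ T? →
          nonadjacent⇒¬biconnected u≢v u≁v (fromDec T?)
            (rec ((λ {y} y∈s → ∈-fromDec⁺ T? (s⊆T y y∈s)) , x , ∈-fromDec⁺ T? Tx , x∉s))
            (∈-fromDec⁺ T? (s⊆T u u∈s)) (∈-fromDec⁺ T? (s⊆T v v∈s))
            (biconnected-resp (λ _ → ∈-fromDec⁺ T?) (λ _ → ∈-fromDec⁻ T?) bicT)

    biconnected⇒complete : Biconnected G S → Complete G S
    biconnected⇒complete {S} bic u v Su Sv u≢v with dec G u v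
    ... | inj₁ u~v = u~v
    ... | inj₂ u≁v = ⊥-elim (¬¬-∀Dec S λ S? →
      nonadjacent⇒¬biconnected u≢v u≁v (fromDec S?) (⊃-wellFounded _)
        (∈-fromDec⁺ S? Su) (∈-fromDec⁺ S? Sv)
        (biconnected-resp (λ _ → ∈-fromDec⁺ S?) (λ _ → ∈-fromDec⁻ S?) bic))

  -- Paths and cycles

  data Path : Fin n → Fin n → List (Fin n) → Set where
    stop : ∀ {u} → Path u u (u ∷ [])
    cons : ∀ {u v w L} → u ∉ L → Adj G u v → Path v w L → Path u w (u ∷ L)

  head∈ : ∀ {L} → Path u w L → u ∈ L
  head∈ stop         = here refl
  head∈ (cons _ _ _) = here refl

  suffix : ∀ {L} → Path u w L → x ∈ L → ∃[ M ] Path x w M × (∀ {y} → y ∈ M → y ∈ L)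
  suffix stop             (here refl) = _ , stop , id
  suffix p@(cons _ _ _)   (here refl) = _ , p , id
  suffix (cons _ _ p)     (there x∈)  with suffix p x∈
  ... | M , q , M⊆L = M , q , there ∘ M⊆L

  open import Data.List.Membership.DecPropositional (Fin._≟_ {n}) using (_∈?_)

  loop-erase : Walk S (Adj G) u w k → ∃[ L ] Path u w L × (∀ {y} → y ∈ L → S y)
  loop-erase (here s) = _ , stop , λ { (here refl) → s }
  loop-erase {u = u} (step s e walk) with loop-erase walk
  ... | L , p , L⊆S with u ∈? L
  ... | no u∉L  = _ , cons u∉L e p , λ { (here refl) → s ; (there y∈) → L⊆S y∈ }
  ... | yes u∈L with suffix p u∈L
  ...   | M , q , M⊆L = M , q , L⊆S ∘ M⊆L

  path-to-end : ∀ {L} → Path u w L → y ∈ L → Joined (_∈ L) (Adj G) y w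
  path-to-end stop           (here refl) = joined-refl (here refl)
  path-to-end (cons _ e p)   (here refl) =
    joined-cons (here refl) e (joined-map (λ _ → there) (path-to-end p (head∈ p)))
  path-to-end (cons _ _ p)   (there y∈)  = joined-map (λ _ → there) (path-to-end p y∈)

  -- Deleting `x` breaks the path into at most two pieces, and each piece contains an end of the
  -- path.
  path-minus : ∀ {L} → Path u w L → ∀ x → y ∈ L → y ≢ x →
               Joined (Minus (_∈ L) x) (Adj G) y u ⊎ Joined (Minus (_∈ L) x) (Adj G) y w
  path-minus stop         x (here refl) y≢x = inj₁ (joined-refl (here refl , y≢x))
  path-minus (cons _ _ _) x (here refl) y≢x = inj₁ (joined-refl (here refl , y≢x))
  path-minus {u = u} (cons u∉L e p) x (there y∈) y≢x with u Fin.≟ x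
  ... | yes refl = inj₂ (joined-map (λ z z∈ → there z∈ , λ { refl → u∉L z∈ }) (path-to-end p y∈))
  ... | no u≢x   = Sum.map
    (λ j → joined-snoc (joined-map (λ _ (z∈ , z≢x) → there z∈ , z≢x) j) (sym G e) (here refl , u≢x))
    (joined-map (λ _ (z∈ , z≢x) → there z∈ , z≢x))
    (path-minus p x y∈ y≢x)

  joined-sym : Joined S (Adj G) u v → Joined S (Adj G) v u
  joined-sym (_ , p) = _ , reverseʷ (sym G) p

  -- If a vertex other than `v` is deleted, `path-minus` still leads to an end of the path, and both
  -- ends are adjacent to `v`. If `v` is deleted, the whole path remains.
  cycle-biconnected : ∀ {L} → Adj G v u → Adj G v w → Path u w L → v ∉ L →
                      Biconnected G (_∈ (v ∷ L))
  cycle-biconnected {v} {u} {w} {L} v~u v~w p v∉L =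
    ((v , here refl) , λ y z y∈ z∈ → joined-trans (to-v y∈) (joined-sym (to-v z∈))) , robust
    where
    C = v ∷ L

    to-v : y ∈ C → Joined (_∈ C) (Adj G) y v
    to-v (here refl) = joined-refl (here refl)
    to-v (there y∈)  =
      joined-snoc (joined-map (λ _ → there) (path-to-end p y∈)) (sym G v~w) (here refl)

    to-v-minus : ∀ x → x ≢ v → Minus (_∈ C) x y → Joined (Minus (_∈ C) x) (Adj G) y v
    to-v-minus x x≢v (here refl , y≢x) = joined-refl (here refl , y≢x)
    to-v-minus x x≢v (there y∈ , y≢x) with path-minus p x y∈ y≢x
    ... | inj₁ j = joined-snoc (joined-map (λ _ (z∈ , z≢x) → there z∈ , z≢x) j)
                     (sym G v~u) (here refl , λ v≡x → x≢v (≡-sym v≡x))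
    ... | inj₂ j = joined-snoc (joined-map (λ _ (z∈ , z≢x) → there z∈ , z≢x) j)
                     (sym G v~w) (here refl , λ v≡x → x≢v (≡-sym v≡x))

    to-w-minus-v : Minus (_∈ C) v y → Joined (Minus (_∈ C) v) (Adj G) y w
    to-w-minus-v (here y≡v , y≢v) = contradiction y≡v y≢v
    to-w-minus-v (there y∈ , _)   =
      joined-map (λ z z∈ → there z∈ , λ { refl → v∉L z∈ }) (path-to-end p y∈)

    robust : ∀ x → x ∈ C → ∀ y z → Minus (_∈ C) x y → Minus (_∈ C) x z →
             Joined (Minus (_∈ C) x) (Adj G) y z
    robust x _ y z y∈ z∈ with x Fin.≟ v
    ... | yes refl = joined-trans (to-w-minus-v y∈) (joined-sym (to-w-minus-v z∈))
    ... | no x≢v   = joined-trans (to-v-minus x x≢v y∈) (joined-sym (to-v-minus x x≢v z∈))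

  -- Loop erasure turns the connection into a path avoiding `v`, and `v` closes it to a cycle. The
  -- cycle is biconnected, hence complete. Most adjacencies below are obtained in this way.
  chord : BlockGraph G → Adj G v u → Adj G v w → Joined (_≢ v) (Adj G) u w → u ≢ w → Adj G u w
  chord block v~u v~w (_ , walk) u≢w with loop-erase walk
  ... | L , p , avoids = biconnected⇒complete block
    (cycle-biconnected v~u v~w p (λ v∈L → avoids v∈L refl))
    _ _ (there (head∈ p)) (there (last∈ p)) u≢w
    where
    last∈ : ∀ {u w L} → Path u w L → w ∈ L
    last∈ stop         = here refl
    last∈ (cons _ _ p) = there (last∈ p)

  -- Triangles in bridgeless block graphs

  Adj? : ∀ u v → Dec (Adj G u v)
  Adj? u v with dec G u v
  ... | inj₁ u~v = yes u~v
  ... | inj₂ u≁v = no u≁v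

  -- Cut the walk at its last visit to `a`, if there is one. The vertex `c` that follows differs
  -- from `b`, because the edge from `a` to `b` has been deleted.
  last-exit : ∀ {a b} → a ≢ b → Walk Everything (AdjMinus G a b) u b k →
              Joined (_≢ a) (Adj G) u b ⊎
              (∃[ c ] Adj G a c × c ≢ b × Joined (_≢ a) (Adj G) c b)
  last-exit a≢b (here _) = inj₁ (joined-refl (λ b≡a → a≢b (≡-sym b≡a)))
  last-exit {u} {a = a} a≢b (step {w = w} _ (u~w , off) walk) with last-exit a≢b walk | u Fin.≟ a
  ... | inj₂ exit | _        = inj₂ exit
  ... | inj₁ j    | yes refl = inj₂ (w , u~w , (λ w≡b → off (inj₁ (refl , w≡b))) , j)
  ... | inj₁ j    | no u≢a   = inj₁ (joined-cons u≢a u~w j)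

  edge-in-triangle : Bridgeless G → BlockGraph G → Adj G u v → ∃[ w ] Adj G u w × Adj G v w
  edge-in-triangle {u} {v} (_ , no-bridge) block u~v =
    -- Bridgelessness only refutes `IsBridge`, so the third vertex is obtained by decidability from
    -- the absurdity of there being none.
    decidable-stable (Fin.any? (λ w → Adj? u w ×-dec Adj? v w)) λ none →
      no-bridge u v (u~v , λ joined → none (search (proj₂ (joined u v))))
    where
    search : Walk Everything (AdjMinus G u v) u v k → ∃[ w ] Adj G u w × Adj G v w
    search walk with last-exit (λ { refl → irrefl G u~v }) walk
    ... | inj₁ (_ , p)               = contradiction refl (source∈ p)
    ... | inj₂ (c , u~c , c≢v , c⇝v) = c , u~c , sym G (chord block u~c u~v c⇝v c≢v)

-- Distances in connected graphs

least : {P : ℕ → Set} → (∀ k → Dec (P k)) → P k → ∃[ m ] P m × (∀ {j} → P j → m ≤ j)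
least {zero}  P? p = zero , p , λ _ → z≤n
least {suc k} P? p with P? zero
... | yes p₀ = zero , p₀ , λ _ → z≤n
... | no ¬p₀ with least (P? ∘ suc) p
...   | m , pm , min = suc m , pm , λ { {zero} p₀ → contradiction p₀ ¬p₀ ; {suc j} pj → s≤s (min pj) }

abstract
  maximum : (f : Fin n → ℕ) → Fin n → ∃[ x ] (∀ y → f y ≤ f x)
  maximum {n} f x =
    argmax f x (allFin n) , λ y → All.lookup (f[xs]≤f[argmax] {f = f} x (allFin n)) (∈-allFin {n} y)

module Distance {n : ℕ} (G : Graph n) (connected : Connected G) where

  walk? : ∀ k u v → Dec (Walk Everything (Adj G) u v k)
  walk? zero    u v = map′ (λ { refl → here tt }) (λ { (here _) → refl }) (u Fin.≟ v)
  walk? (suc k) u v = map′ (λ (w , u~w , p) → step tt u~w p) (λ { (step _ u~w p) → _ , u~w , p })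
    (Fin.any? (λ w → Adj? G u w ×-dec walk? k w v))

  abstract
    shortest : ∀ u v → ∃[ m ] Walk Everything (Adj G) u v m ×
               (∀ {j} → Walk Everything (Adj G) u v j → m ≤ j)
    shortest u v = least (λ k → walk? k u v) (proj₂ (connected u v))

  dist : Fin n → Fin n → ℕ
  dist u v = proj₁ (shortest u v)

  geodesic : ∀ u v → Walk Everything (Adj G) u v (dist u v)
  geodesic u v = proj₁ (proj₂ (shortest u v))

  dist-min : Walk Everything (Adj G) u v k → dist u v ≤ k
  dist-min {u} {v} = proj₂ (proj₂ (shortest u v))

  dist-refl : ∀ u → dist u u ≡ 0
  dist-refl u = n≤0⇒n≡0 (dist-min {u} (here tt))

  dist-sym : ∀ u v → dist u v ≡ dist v u
  dist-sym u v = ≤-antisym (dist-min (reverseʷ (sym G) (geodesic v u)))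
                           (dist-min (reverseʷ (sym G) (geodesic u v)))

  dist≡0⇒≡ : dist u v ≡ 0 → u ≡ v
  dist≡0⇒≡ {u} {v} eq with dist u v | geodesic u v
  dist≡0⇒≡ refl | zero | here _ = refl

  dist-adj : Adj G v w → ∀ o → dist o w ≤ suc (dist o v)
  dist-adj {v} v~w o = dist-min (snocʷ (geodesic o v) v~w tt)

  dist-triangle : ∀ u v w → dist u w ≤ dist u v + dist v w
  dist-triangle u v w = dist-min (geodesic u v ++ʷ geodesic v w)

  farthest : ∀ u → ∃[ v ] (∀ w → dist u w ≤ dist u v)
  farthest u = maximum (dist u) u

  diametral : Fin n → ∃[ ρ ] ∃[ σ ] (∀ u v → dist u v ≤ dist ρ σ)
  diametral x =
    let ρ , ρ-max = maximum (λ u → dist u (proj₁ (farthest u))) x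
    in ρ , proj₁ (farthest ρ) , λ u v → ≤-trans (proj₂ (farthest u) v) (ρ-max u)

  data Step (o v w : Fin n) : Set where
    up    : dist o w ≡ suc (dist o v) → Step o v w
    level : dist o w ≡ dist o v → Step o v w
    down  : dist o v ≡ suc (dist o w) → Step o v w

  compare-adj : ∀ o → Adj G v w → Step o v w
  compare-adj {v} {w} o v~w with <-cmp (dist o v) (dist o w)
  ... | tri< lt _ _ = up (≤-antisym (dist-adj v~w o) lt)
  ... | tri≈ _ eq _ = level (≡-sym eq)
  ... | tri> _ _ gt = down (≤-antisym (dist-adj (sym G v~w) o) gt)

  parent : dist u v ≡ suc k → ∃[ w ] Adj G v w × dist u w ≡ k
  parent {u} {v} eq with dist v u | trans (≡-sym (dist-sym u v)) eq | geodesic v u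
  ... | suc k | refl | step {w = w} _ v~w p =
    w , v~w , ≤-antisym (dist-min (reverseʷ (sym G) p))
                        (≤-pred (subst (_≤ suc (dist u w)) eq (dist-adj (sym G v~w) u)))

  -- Distance layers of a block graph

  module _ (block : BlockGraph G) where

    -- After its first vertex, a geodesic from `w` to `o` stays strictly nearer to `o` than `y` is.
    to-root-avoiding : ∀ {o} → w ≢ y → dist o w ≤ dist o y → Joined (_≢ y) (Adj G) w o
    to-root-avoiding {w} {y} {o} w≢y le = go (dist o w) w refl w≢y le
      where
      go : ∀ k w → dist o w ≡ k → w ≢ y → k ≤ dist o y → Joined (_≢ y) (Adj G) w o
      go zero    w eq w≢y _ with refl ← dist≡0⇒≡ eq = joined-refl w≢y
      go (suc k) w eq w≢y lt with parent eq
      ... | w′ , w~w′ , eq′ = joined-cons w≢y w~w′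
        (go k w′ eq′ (λ { refl → <-irrefl (≡-sym eq′) lt }) (≤-trans (n≤1+n k) lt))

    joined-avoiding : ∀ o → v ≢ y → w ≢ y → dist o v ≤ dist o y → dist o w ≤ dist o y →
                      Joined (_≢ y) (Adj G) v w
    joined-avoiding o v≢y w≢y le le′ =
      joined-trans (to-root-avoiding v≢y le) (joined-sym G (to-root-avoiding w≢y le′))

    parent≢ : ∀ {o} {p : Fin n} → dist o y ≡ suc (dist o p) → p ≢ y
    parent≢ eq refl = 1+n≢n (≡-sym eq)

    parent≤ : ∀ {o} {p : Fin n} → dist o y ≡ suc (dist o p) → dist o p ≤ dist o y
    parent≤ eq = ≤-trans (n≤1+n _) (≤-reflexive (≡-sym eq))

    -- Neither `y′` nor `p` is farther from `o` than `y`, so they are connected through `o` without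
    -- `y`, and `chord` applies at `y`.
    siblings-share-parent : ∀ o {y′ p : Fin n} → Adj G y y′ → dist o y′ ≡ dist o y →
                            Adj G y p → dist o y ≡ suc (dist o p) → Adj G y′ p
    siblings-share-parent {y} o {y′} {p} y~y′ same y~p eq =
      chord G block y~y′ y~p
        (joined-avoiding o (λ { refl → irrefl G y~y′ }) (parent≢ eq) (≤-reflexive same) (parent≤ eq))
        (λ { refl → 1+n≢n (trans (≡-sym eq) (≡-sym same)) })

    -- Distinct parents would be adjacent siblings by `chord` at `y`, so they would share a parent
    -- `q`. Then `y` reaches `q` through `p′` without `p`, and `chord` at `p` makes `y` adjacent to
    -- `q`, two layers nearer to `o`. If the parents lie in layer zero, both equal `o`.
    parent-unique : ∀ o {p p′ : Fin n} → Adj G y p → dist o y ≡ suc (dist o p) →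
                    Adj G y p′ → dist o y ≡ suc (dist o p′) → p ≡ p′
    parent-unique {y} o {p} {p′} y~p eq y~p′ eq′ with p Fin.≟ p′
    ... | yes p≡p′ = p≡p′
    ... | no p≢p′  = absurd (dist o p) refl
      where
      p~p′ : Adj G p p′
      p~p′ = chord G block y~p y~p′
        (joined-avoiding o (parent≢ eq) (parent≢ eq′) (parent≤ eq) (parent≤ eq′)) p≢p′

      same : dist o p′ ≡ dist o p
      same = suc-injective (trans (≡-sym eq′) eq)

      absurd : ∀ k → dist o p ≡ k → p ≡ p′
      absurd zero    e = trans (≡-sym (dist≡0⇒≡ e)) (dist≡0⇒≡ (trans same e))
      absurd (suc k) e with parent e
      ... | q , p~q , eq″ = contradiction y~q λ y~q → 1+n≰n (begin
          suc (suc (dist o q)) ≡⟨ cong suc p≡ ⟨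
          suc (dist o p)       ≡⟨ eq ⟨
          dist o y             ≤⟨ dist-adj (sym G y~q) o ⟩
          suc (dist o q)       ∎)
        where
        open ≤-Reasoning
        p≡ : dist o p ≡ suc (dist o q)
        p≡ = trans e (cong suc (≡-sym eq″))
        y~q : Adj G y q
        y~q = chord G block (sym G y~p) p~q
          (joined-cons (λ { refl → irrefl G y~p }) y~p′
            (joined-cons (λ { refl → irrefl G p~p′ })
              (siblings-share-parent o p~p′ same p~q p≡)
              (joined-refl (λ { refl → irrefl G p~q }))))
          (λ { refl → m≢1+m+n (dist o q) {1} (trans eq (trans (cong suc p≡) (cong suc (+-comm 1 (dist o q))))) })

    -- If `s` were level with `q`, it would be adjacent to the parent `p`; if it were nearer to `o`,
    -- it would be that parent.
    extend : ∀ o {p q s : Fin n} → Adj G q p → dist o q ≡ suc (dist o p) →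
             Adj G q s → s ≢ p → ¬ Adj G s p → dist o s ≡ suc (dist o q)
    extend o q~p eq q~s s≢p s≁p with compare-adj o q~s
    ... | up e    = e
    ... | level e = contradiction (siblings-share-parent o q~s e q~p eq) s≁p
    ... | down e  = contradiction (parent-unique o q~s e q~p eq) s≢p

    apex : ∀ o {p q : Fin n} → Adj G p q → dist o q ≡ suc (dist o p) →
           Adj G p w → Adj G q w → dist o w ≡ dist o q
    apex o p~q eq p~w q~w with compare-adj o q~w
    ... | up e    = contradiction (dist-adj p~w o) (<⇒≱ (≤-reflexive (≡-sym (trans e (cong suc eq)))))
    ... | level e = e
    ... | down e with refl ← parent-unique o (sym G p~q) eq q~w e = contradiction p~w (irrefl G)

    -- An edge that leads away from ρ and towards σ lies on a geodesic.
    monotone-edge : ∀ ρ σ {p q : Fin n} → Adj G p q → dist ρ q ≡ suc (dist ρ p) →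
                    dist σ p ≡ suc (dist σ q) → dist ρ q + dist σ q ≡ dist ρ σ
    monotone-edge ρ σ p~q up-ρ down-σ = go _ p~q up-ρ down-σ refl
      where
      go : ∀ k {p q} → Adj G p q → dist ρ q ≡ suc (dist ρ p) → dist σ p ≡ suc (dist σ q) →
           dist σ q ≡ k → dist ρ q + dist σ q ≡ dist ρ σ
      go zero {q = q} _ _ _ e with refl ← dist≡0⇒≡ e =
        trans (cong (dist ρ σ +_) (dist-refl σ)) (+-identityʳ (dist ρ σ))
      go (suc k) {p} {q} p~q up-ρ down-σ e with parent e
      ... | s , q~s , es = begin
          dist ρ q + dist σ q       ≡⟨ cong (dist ρ q +_) q≡ ⟩
          dist ρ q + suc (dist σ s) ≡⟨ +-suc _ _ ⟩
          suc (dist ρ q + dist σ s) ≡⟨ cong (_+ dist σ s) s≡ ⟨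
          dist ρ s + dist σ s       ≡⟨ go k q~s s≡ q≡ es ⟩
          dist ρ σ                  ∎
        where
        open ≡-Reasoning
        q≡ : dist σ q ≡ suc (dist σ s)
        q≡ = trans e (cong suc (≡-sym es))
        far : dist σ p ≡ suc (suc (dist σ s))
        far = trans down-σ (cong suc q≡)
        -- Since `p` is two farther from `σ` than `s`, the vertices `p` and `s` are neither equal
        -- nor adjacent, so `extend` applies.
        s≡ : dist ρ s ≡ suc (dist ρ q)
        s≡ = extend ρ (sym G p~q) up-ρ q~s
          (λ { refl → m≢1+m+n (dist σ s) {1} (trans far (cong suc (+-comm 1 (dist σ s)))) })
          (λ s~p → 1+n≰n (subst (_≤ suc (dist σ s)) far (dist-adj s~p σ)))

-- The orientation induced by an injective ranking of the vertices

-- In every block, with first and second its two vertices of least rank, the arcs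
-- run first → second → others → first. For κ u < κ v the edge uv points backwards
-- exactly if u is first and v is neither first nor second.
module Rank {n : ℕ} (G : Graph n) (block : BlockGraph G)
            (triangle : ∀ {u v} → Adj G u v → ∃[ w ] Adj G u w × Adj G v w)
            (κ : Fin n → ℕ) (κ-injective : ∀ {u v} → κ u ≡ κ v → u ≡ v) where

  Common : Fin n → Fin n → Fin n → Set
  Common u v w = Adj G u w × Adj G v w

  Common? : ∀ u v w → Dec (Common u v w)
  Common? u v w = Adj? G u w ×-dec Adj? G v w

  Backward : Fin n → Fin n → Set
  Backward u v = (∃[ w ] Common u v w × κ u < κ w × κ w < κ v) ×
                 ¬ (∃[ w ] Common u v w × κ w < κ u)

  backward? : ∀ u v → Dec (Backward u v)
  backward? u v =
    Fin.any? (λ w → Common? u v w ×-dec (κ u <? κ w ×-dec κ w <? κ v)) ×-dec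
    ¬? (Fin.any? (λ w → Common? u v w ×-dec κ w <? κ u))

  adj-κ≢ : Adj G u v → κ u ≢ κ v
  adj-κ≢ {v = v} u~v eq = irrefl G (subst (λ x → Adj G x v) (κ-injective eq) u~v)

  orient : Orientation G
  orient .Arc u v = Adj G u v × ((κ u < κ v × ¬ Backward u v) ⊎ (κ v < κ u × Backward v u))
  orient .arc-edge = proj₁
  orient .total {u} {v} u~v with <-cmp (κ u) (κ v)
  ... | tri≈ _ eq _ = contradiction eq (adj-κ≢ u~v)
  ... | tri< lt _ _ with backward? u v
  ...   | yes back = inj₂ (sym G u~v , inj₂ (lt , back))
  ...   | no ¬back = inj₁ (u~v , inj₁ (lt , ¬back))
  orient .total {u} {v} u~v | tri> _ _ gt with backward? v u
  ...   | yes back = inj₁ (u~v , inj₂ (gt , back))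
  ...   | no ¬back = inj₂ (sym G u~v , inj₁ (gt , ¬back))
  orient .antisym (_ , inj₁ (lt , _))     (_ , inj₁ (gt , _))    = <-asym lt gt
  orient .antisym (_ , inj₁ (_ , ¬back))  (_ , inj₂ (_ , back))  = ¬back back
  orient .antisym (_ , inj₂ (_ , back))   (_ , inj₁ (_ , ¬back)) = ¬back back
  orient .antisym (_ , inj₂ (gt , _))     (_ , inj₂ (lt , _))    = <-asym lt gt

  -- In a block graph the common neighbours of an edge are the other vertices of its block. This
  -- describes the two lowest-ranked vertices of a block without naming the block.
  record Top (f s : Fin n) : Set where
    field
      adjacent : Adj G f s
      ordered  : κ f < κ s
      least-κ  : ∀ {w} → Common f s w → κ s < κ w

  module _ {f s : Fin n} (top : Top f s) where
    open Top top

    first→second : Arc orient f s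
    first→second = adjacent , inj₁ (ordered , λ ((w , c , _ , w<s) , _) → <-asym w<s (least-κ c))

    second→other : Common f s w → Arc orient s w
    second→other c@(f~w , s~w) =
      s~w , inj₁ (least-κ c , λ (_ , none) → none (f , (sym G adjacent , sym G f~w) , ordered))

    other→first : Common f s w → Arc orient w f
    other→first {w} c@(f~w , s~w) = sym G f~w ,
      inj₂ (<-trans ordered (least-κ c) , (s , (adjacent , sym G s~w) , ordered , least-κ c) , none)
      where
      -- A lower-ranked `x` would lie in the same block: either it is `s`, or `chord` makes it a
      -- common neighbour of `f` and `s`. Both contradict `top`.
      none : ¬ (∃[ x ] Common f w x × κ x < κ f)
      none (x , (f~x , w~x) , x<f) with s Fin.≟ x
      ... | yes refl = <-asym x<f ordered
      ... | no s≢x   = <-asym x<f (<-trans ordered (least-κ (f~x , s~x)))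
        where
        s~x : Adj G s x
        s~x = chord G block adjacent f~x
          (joined-cons (λ { refl → irrefl G adjacent }) s~w
            (joined-cons (λ { refl → irrefl G f~w }) w~x
              (joined-refl (λ { refl → irrefl G f~x })))) s≢x

  -- Directed distances within one block

  dist-arc : Arc orient u v → DistLe orient u v 1
  dist-arc e = 1 , ≤-refl , step tt e (here tt)

  dist-cons : Arc orient u v → DistLe orient v w k → DistLe orient u w (suc k)
  dist-cons e (j , j≤k , p) = suc j , s≤s j≤k , step tt e p

  distLe-trans : DistLe orient u v j → DistLe orient v w k → DistLe orient u w (j + k)
  distLe-trans (i , i≤j , p) (i′ , i′≤k , q) = i + i′ , +-mono-≤ i≤j i′≤k , p ++ʷ q

  Near : Fin n → Fin n → ℕ → Set
  Near u v k = DistLe orient u v k × DistLe orient v u k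

  near-refl : Near u u 0
  near-refl = (0 , z≤n , here tt) , (0 , z≤n , here tt)

  near-sym : Near u v k → Near v u k
  near-sym (uv , vu) = vu , uv

  near-mono : j ≤ k → Near u v j → Near u v k
  near-mono j≤k ((i , le , p) , (i′ , le′ , p′)) =
    (i , ≤-trans le j≤k , p) , (i′ , ≤-trans le′ j≤k , p′)

  near-trans : Near u v j → Near v w k → Near u w (j + k)
  near-trans {j = j} {k = k} (uv , vu) (vw , wv) =
    distLe-trans uv vw , subst (DistLe orient _ _) (+-comm k j) (distLe-trans wv vu)

  module _ {f s : Fin n} (top : Top f s) where

    -- The triangle hypothesis supplies a third vertex of the block, through which the way back
    -- leads.
    second⇝first : DistLe orient s f 2
    second⇝first with w , c ← triangle (Top.adjacent top) =
      dist-cons (second→other top c) (dist-arc (other→first top c))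

    near-first-second : Near f s 2
    near-first-second = (1 , s≤s z≤n , step tt (first→second top) (here tt)) , second⇝first

    near-first-other : Common f s w → Near f w 2
    near-first-other c = dist-cons (first→second top) (dist-arc (second→other top c)) ,
      (1 , s≤s z≤n , step tt (other→first top c) (here tt))

    near-second-other : Common f s w → Near s w 2
    near-second-other c = (1 , s≤s z≤n , step tt (second→other top c) (here tt)) ,
      dist-cons (other→first top c) (dist-arc (first→second top))

    near-others : Common f s v → Common f s w → Near v w 3
    near-others c c′ = around c c′ , around c′ c
      where
      around : Common f s v → Common f s w → DistLe orient v w 3
      around c c′ = dist-cons (other→first top c)
        (dist-cons (first→second top) (dist-arc (second→other top c′)))

  -- If no common neighbour ranks below `y`, then `y` is second in the block. Otherwise the
  -- lowest-ranked common neighbour `s` is second and `y` is one of the others.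
  near-first : ∀ {f} → Adj G f y → κ f < κ y → (∀ {w} → Common f y w → κ f < κ w) → Near f y 2
  near-first {y} {f} f~y f<y f-least with Fin.any? (λ w → Common? f y w ×-dec κ w <? κ y)
  ... | no none = near-first-second record
    { adjacent = f~y
    ; ordered  = f<y
    ; least-κ  = λ {w} c@(_ , y~w) → ≤∧≢⇒< (≮⇒≥ (λ w<y → none (w , c , w<y))) (adj-κ≢ y~w)
    }
  ... | yes (w₀ , c₀ , w₀<y)
    with _ , (s , c@(f~s , y~s) , refl) , s-least ←
      least {P = λ k → ∃[ w ] Common f y w × κ w ≡ k}
        (λ k → Fin.any? (λ w → Common? f y w ×-dec κ w ≟ k)) (w₀ , c₀ , refl) =
    near-first-other record { adjacent = f~s ; ordered = f-least c ; least-κ = above }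
      (f~y , sym G y~s)
    where
    s<y : κ s < κ y
    s<y = ≤-<-trans (s-least (w₀ , c₀ , refl)) w₀<y

    above : ∀ {w} → Common f s w → κ s < κ w
    above {w} (f~w , s~w) with y Fin.≟ w
    ... | yes refl = s<y
    ... | no y≢w   = ≤∧≢⇒< (s-least (w , (f~w , y~w) , refl)) (adj-κ≢ s~w)
      where
      y~w : Adj G y w
      y~w = chord G block f~y f~w
        (joined-cons (λ { refl → irrefl G f~y }) y~s
          (joined-cons (λ { refl → irrefl G f~s }) s~w
            (joined-refl (λ { refl → irrefl G f~w })))) y≢w

-- Path costs and the bound

-- cost m = ⌈3m/2⌉
cost : ℕ → ℕ
cost 0             = 0
cost 1             = 2
cost (suc (suc m)) = 3 + cost m

2*cost≤ : ∀ m → 2 * cost m ≤ 3 * m + 1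
2*cost≤ 0 = z≤n
2*cost≤ 1 = ≤-refl
2*cost≤ (suc (suc m)) = begin
  2 * (3 + cost m)    ≡⟨ lhs (cost m) ⟩
  6 + 2 * cost m      ≤⟨ +-monoʳ-≤ 6 (2*cost≤ m) ⟩
  6 + (3 * m + 1)     ≡⟨ rhs m ⟩
  3 * (2 + m) + 1     ∎
  where
  open ≤-Reasoning
  lhs : ∀ c → 2 * (3 + c) ≡ 6 + 2 * c
  lhs = solve-∀
  rhs : ∀ m → 6 + (3 * m + 1) ≡ 3 * (2 + m) + 1
  rhs = solve-∀

-- Here `e` is the cost of a middle stretch of length `m`, and each level of depth costs 2. After
-- doubling, depth has coefficient 4, of which 3 are absorbed by `t₁ + m + t₂ ≤ r`.
total-cost : ∀ t₁ t₂ m e r → t₁ + m + t₂ ≤ r → 2 * e ≤ 3 * m + 3 →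
             2 * (t₁ + t₁ + e + (t₂ + t₂)) ≤ 3 * r + (t₁ + t₂) + 3
total-cost t₁ t₂ m e r r≥ 2e≤ = begin
  2 * (t₁ + t₁ + e + (t₂ + t₂))            ≡⟨ lhs t₁ t₂ e ⟩
  4 * (t₁ + t₂) + 2 * e                    ≤⟨ +-monoʳ-≤ (4 * (t₁ + t₂)) 2e≤ ⟩
  4 * (t₁ + t₂) + (3 * m + 3)              ≡⟨ rhs t₁ t₂ m ⟩
  3 * (t₁ + m + t₂) + (t₁ + t₂) + 3        ≤⟨ +-monoˡ-≤ 3 (+-monoˡ-≤ (t₁ + t₂) (*-monoʳ-≤ 3 r≥)) ⟩
  3 * r + (t₁ + t₂) + 3                    ∎
  where
  open ≤-Reasoning
  lhs : ∀ t₁ t₂ e → 2 * (t₁ + t₁ + e + (t₂ + t₂)) ≡ 4 * (t₁ + t₂) + 2 * e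
  lhs = solve-∀
  rhs : ∀ t₁ t₂ m → 4 * (t₁ + t₂) + (3 * m + 3) ≡ 3 * (t₁ + m + t₂) + (t₁ + t₂) + 3
  rhs = solve-∀

≤-quarter : ∀ {k m} → 4 * k ≤ m → k ≤ m / 4
≤-quarter {k} {m} 4k≤m = begin
  k             ≡⟨ m*n/n≡m k 4 ⟨
  (k * 4) / 4   ≤⟨ /-monoˡ-≤ 4 (subst (_≤ m) (*-comm 4 k) 4k≤m) ⟩
  m / 4         ∎
  where open ≤-Reasoning

4k≤6[1+M] : ∀ M k → 2 * k ≤ 3 * M + 3 → 4 * k ≤ 6 * suc M
4k≤6[1+M] M k 2k≤ = subst₂ _≤_ (≡-sym (lhs k)) (rhs M) (*-monoʳ-≤ 2 2k≤)
  where
  lhs : ∀ k → 4 * k ≡ 2 * (2 * k)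
  lhs = solve-∀
  rhs : ∀ M → 2 * (3 * M + 3) ≡ 6 * suc M
  rhs = solve-∀

-- For even `n` the hypothesis improves to `2 * M + 2 ≤ n`, so `6 * suc M ≤ 3 * n`. For odd `n` it
-- only gives `6 * suc M ≤ 3 * (n + 1)`. Hence the two cases of the bound.
≤-bound : ∀ {n} M k → suc (M * 2) ≤ n → 2 * k ≤ 3 * M + 3 → k ≤ bound n
≤-bound {n} M k n≥ 2k≤ with n % 2 | m≡m%n+[m/n]*n n 2 | m%n<n n 2
... | zero | n≡ | _ = ≤-quarter (begin
  4 * k              ≤⟨ 4k≤6[1+M] M k 2k≤ ⟩
  6 * suc M          ≤⟨ *-monoʳ-≤ 6 (*-cancelʳ-< 2 M (n / 2) (subst (M * 2 <_) n≡ n≥)) ⟩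
  6 * (n / 2)        ≡⟨ half (n / 2) ⟩
  3 * (n / 2 * 2)    ≡⟨ cong (3 *_) n≡ ⟨
  3 * n              ∎)
  where
  open ≤-Reasoning
  half : ∀ q → 6 * q ≡ 3 * (q * 2)
  half = solve-∀
... | suc zero | n≡ | _ = ≤-quarter (begin
  4 * k                        ≤⟨ 4k≤6[1+M] M k 2k≤ ⟩
  6 * suc M                    ≤⟨ *-monoʳ-≤ 6 (s≤s (*-cancelʳ-≤ M (n / 2) 2 (≤-pred (subst (suc (M * 2) ≤_) n≡ n≥)))) ⟩
  6 * suc (n / 2)              ≡⟨ half (n / 2) ⟩
  3 * (suc (n / 2 * 2) + 1)    ≡⟨ cong (λ n → 3 * (n + 1)) n≡ ⟨
  3 * (n + 1)                  ∎)
  where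
  open ≤-Reasoning
  half : ∀ q → 6 * suc q ≡ 3 * (suc (q * 2) + 1)
  half = solve-∀
... | suc (suc _) | _ | s≤s (s≤s ())

-- With `t` the larger depth, `t₁ + t₂ ≤ 2 * t ≤ 3 * t`, which reduces the claim to `≤-bound` with
-- `M = r + t`.
≤-bound₂ : ∀ {n} r t₁ t₂ k → suc ((r + t₁) * 2) ≤ n → suc ((r + t₂) * 2) ≤ n →
           2 * k ≤ 3 * r + (t₁ + t₂) + 3 → k ≤ bound n
≤-bound₂ {n} r t₁ t₂ k n≥₁ n≥₂ 2k≤ = Sum.[ from n≥₂ ∘ +-monoˡ-≤ t₂ , from n≥₁ ∘ +-monoʳ-≤ t₁ ]
  (≤-total t₁ t₂)
  where
  from : ∀ {t} → suc ((r + t) * 2) ≤ n → t₁ + t₂ ≤ t + t → k ≤ bound n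
  from {t} n≥ sum≤ = ≤-bound (r + t) k n≥ (begin
    2 * k                    ≤⟨ 2k≤ ⟩
    3 * r + (t₁ + t₂) + 3    ≤⟨ +-monoˡ-≤ 3 (+-monoʳ-≤ (3 * r) (≤-trans sum≤ (+-monoʳ-≤ t (m≤m+n t _)))) ⟩
    3 * r + 3 * t + 3        ≡⟨ cong (_+ 3) (*-distribˡ-+ 3 r t) ⟨
    3 * (r + t) + 3          ∎)
    where open ≤-Reasoning

-- An end of width 1 costs 2, half a unit above the rate 3/2. After doubling, the two ends exceed
-- the rate by at most 2 and the rounding in `cost` by at most 1.
separated-cost : ∀ m {x y} → x ≤ 1 → y ≤ 1 → 2 * (x * 2 + cost m + y * 2) ≤ 3 * (x + m + y) + 3
separated-cost m {x} {y} x≤1 y≤1 = begin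
  2 * (x * 2 + cost m + y * 2)              ≡⟨ lhs x y (cost m) ⟩
  2 * cost m + (x + y) + 3 * (x + y)        ≤⟨ +-monoˡ-≤ (3 * (x + y)) (+-mono-≤ (2*cost≤ m) (+-mono-≤ x≤1 y≤1)) ⟩
  3 * m + 1 + 2 + 3 * (x + y)               ≡⟨ rhs x y m ⟩
  3 * (x + m + y) + 3                       ∎
  where
  open ≤-Reasoning
  lhs : ∀ x y c → 2 * (x * 2 + c + y * 2) ≡ 2 * c + (x + y) + 3 * (x + y)
  lhs = solve-∀
  rhs : ∀ x y m → 3 * m + 1 + 2 + 3 * (x + y) ≡ 3 * (x + m + y) + 3
  rhs = solve-∀

-- The parity of the argument.
alt : ℕ → ℕ
alt zero    = 0
alt (suc m) = 1 ∸ alt m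

alt-suc : ∀ m → (alt m ≡ 0 × alt (suc m) ≡ 1) ⊎ (alt m ≡ 1 × alt (suc m) ≡ 0)
alt-suc zero = inj₁ (refl , refl)
alt-suc (suc m) with alt-suc m
... | inj₁ (e , e′) = inj₂ (e′ , cong (1 ∸_) e′)
... | inj₂ (e , e′) = inj₁ (e′ , cong (1 ∸_) e′)

lookup-injective : ∀ {A : Set} {L : List A} → Unique L → ∀ {i j} → lookup L i ≡ lookup L j → i ≡ j
lookup-injective (_ ∷ _)  {zero}  {zero}  _  = refl
lookup-injective (x∉ ∷ _) {zero}  {suc j} eq = contradiction eq (All.lookup x∉ (∈-lookup j))
lookup-injective (x∉ ∷ _) {suc i} {zero}  eq = contradiction (≡-sym eq) (All.lookup x∉ (∈-lookup i))
lookup-injective (_ ∷ L!) {suc i} {suc j} eq = cong suc (lookup-injective L! eq)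

unique⇒length≤ : {L : List (Fin n)} → Unique L → length L ≤ n
unique⇒length≤ L! = Fin.injective⇒≤ (lookup-injective L!)

-- Position of the vertices relative to a longest geodesic

module Frame {n : ℕ} (G : Graph n) (connected : Connected G) (block : BlockGraph G)
             (triangle : ∀ {u v} → Adj G u v → ∃[ w ] Adj G u w × Adj G v w) where
  open Distance G connected

  module _ (ρ σ : Fin n) (longest : ∀ u v → dist u v ≤ dist ρ σ) where

    r : ℕ
    r = dist ρ σ

    a b : Fin n → ℕ
    a = dist ρ
    b = dist σ

    -- P is taken as the set of all vertices on geodesics from `ρ` to `σ`; by `P-unique` it has only
    -- one vertex at each distance from `ρ`.
    OnP : Fin n → Set
    OnP w = a w + b w ≡ r

    r≤a+b : ∀ w → r ≤ a w + b w
    r≤a+b w = subst (λ d → r ≤ a w + d) (dist-sym w σ) (dist-triangle ρ w σ)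

    -- It is 0 on P, 1 at the remaining vertices of a block containing an edge of P, and grows by 2
    -- with each further step away.
    excess : Fin n → ℕ
    excess w = a w + b w ∸ r

    a+b≡r+excess : ∀ w → a w + b w ≡ r + excess w
    a+b≡r+excess w = ≡-sym (m+[n∸m]≡n (r≤a+b w))

    excess-unique : a w + b w ≡ r + k → excess w ≡ k
    excess-unique {w} eq = +-cancelˡ-≡ r _ _ (trans (≡-sym (a+b≡r+excess w)) eq)

    excess-P : OnP w → excess w ≡ 0
    excess-P on = excess-unique (trans on (≡-sym (+-identityʳ r)))

    -- Edges of P and vertices off P

    record PEdge (p q : Fin n) : Set where
      constructor pedge
      field
        p~q : Adj G p q
        onp : OnP p
        onq : OnP q
        a-suc : a q ≡ suc (a p)

      b-suc : b p ≡ suc (b q)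
      b-suc = +-cancelˡ-≡ (a p) _ _ (begin
        a p + b p         ≡⟨ onp ⟩
        r                 ≡⟨ onq ⟨
        a q + b q         ≡⟨ cong (_+ b q) a-suc ⟩
        suc (a p) + b q   ≡⟨ +-suc (a p) (b q) ⟨
        a p + suc (b q)   ∎)
        where open ≡-Reasoning

    P-edge : ∀ {p q} → Adj G p q → a q ≡ suc (a p) → b p ≡ suc (b q) → PEdge p q
    P-edge {p} {q} p~q ea eb = pedge p~q onp onq ea
      where
      onq : OnP q
      onq = monotone-edge block ρ σ p~q ea eb
      onp : OnP p
      onp = trans (trans (cong (a p +_) eb) (+-suc (a p) (b q))) (trans (cong (_+ b q) (≡-sym ea)) onq)

    data Hang (y : Fin n) : Set where
      below  : ∀ {g} → Adj G g y → a y ≡ suc (a g) → b y ≡ suc (b g) → Hang y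
      inside : ∀ {p q} → PEdge p q → Adj G p y → Adj G q y → a y ≡ a q → b y ≡ b p → Hang y

    -- Compare `y` with its parent `p` towards `ρ` as seen from `σ`, and with its parent `q` towards
    -- `σ` as seen from `ρ`. A parent that is nearer there too is a gate. One that is farther would
    -- put `y` on P by `monotone-edge`. If both are level, they are adjacent and span an edge of P.
    hang : ∀ y → ¬ OnP y → Hang y
    hang y off = split (a y) (b y) refl refl
      where
      cases : ∀ {p q} → Adj G y p → Adj G y q → a y ≡ suc (a p) → b y ≡ suc (b q) →
              Step σ y p → Step ρ y q → Hang y
      cases y~p y~q ap bq (down e)  _         = below (sym G y~p) ap e
      cases y~p y~q ap bq (up e)    _         = contradiction (PEdge.onq (P-edge (sym G y~p) ap e)) off
      cases y~p y~q ap bq (level _) (down e)  = below (sym G y~q) e bq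
      cases y~p y~q ap bq (level _) (up e)    = contradiction (PEdge.onp (P-edge y~q e bq)) off
      cases y~p y~q ap bq (level e) (level f) =
        inside (P-edge (siblings-share-parent block σ y~p e y~q bq) (trans f ap) (trans e bq))
          (sym G y~p) (sym G y~q) (≡-sym f) (≡-sym e)

      split : ∀ i j → a y ≡ i → b y ≡ j → Hang y
      split zero _ ea _ with refl ← dist≡0⇒≡ ea =
        contradiction (cong₂ _+_ (dist-refl ρ) (dist-sym σ ρ)) off
      split (suc _) zero _ eb with refl ← dist≡0⇒≡ eb =
        contradiction (trans (cong (r +_) (dist-refl σ)) (+-identityʳ r)) off
      split (suc i) (suc j) ea eb with parent ea | parent eb
      ... | p , y~p , ep | q , y~q , eq =
        cases y~p y~q (trans ea (cong suc (≡-sym ep))) (trans eb (cong suc (≡-sym eq)))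
          (compare-adj σ y~p) (compare-adj ρ y~q)

    -- A step towards `σ` lowers `b` by one, and the triangle inequality `r≤a+b` then forces `a` to
    -- rise.
    P-next : ∀ {p} → OnP p → b p ≡ suc k → ∃[ q ] PEdge p q × b q ≡ k
    P-next {k} {p} on eb with parent eb
    ... | q , p~q , eq = q , P-edge p~q (≤-antisym (dist-adj p~q ρ) aq≥) bp , eq
      where
      open ≤-Reasoning
      bp : b p ≡ suc (b q)
      bp = trans eb (cong suc (≡-sym eq))
      aq≥ : suc (a p) ≤ a q
      aq≥ = +-cancelʳ-≤ (b q) _ _ (begin
        suc (a p) + b q   ≡⟨ +-suc (a p) (b q) ⟨
        a p + suc (b q)   ≡⟨ cong (a p +_) bp ⟨
        a p + b p         ≡⟨ on ⟩
        r                 ≤⟨ r≤a+b q ⟩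
        a q + b q         ∎)

    -- Induction from the `σ` end: the next vertices on P coincide, and `p` and `p′` are both
    -- parents of that vertex as seen from `ρ`.
    P-unique : ∀ {p p′} → OnP p → OnP p′ → a p ≡ a p′ → p ≡ p′
    P-unique {p} {p′} on on′ ea = go _ on on′ ea refl (≡-sym b≡)
      where
      b≡ : b p ≡ b p′
      b≡ = +-cancelˡ-≡ (a p) _ _ (trans on (trans (≡-sym on′) (cong (_+ b p′) (≡-sym ea))))

      go : ∀ k {p p′} → OnP p → OnP p′ → a p ≡ a p′ → b p ≡ k → b p′ ≡ k → p ≡ p′
      go zero    on on′ ea eb eb′ = trans (≡-sym (dist≡0⇒≡ eb)) (dist≡0⇒≡ eb′)
      go (suc k) on on′ ea eb eb′ with P-next on eb | P-next on′ eb′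
      ... | q , pedge p~q _ onq aq , bq | q′ , pedge p′~q′ _ onq′ aq′ , bq′
        with refl ← go k onq onq′ (trans aq (trans (cong suc ea) (≡-sym aq′))) bq bq′ =
        parent-unique block ρ (sym G p~q) aq (sym G p′~q′) aq′

    -- The P-vertices of even and of odd distance to ρ get ranks 0 and 1, so
    -- consecutive edges of P are oriented in opposite directions.
    key-of : ℕ → ℕ → ℕ
    key-of zero    d = alt d
    key-of (suc e) _ = 2 + e

    key : Fin n → ℕ
    key w = key-of (excess w) (a w)

    -- Lexicographic order by `key`, with ties broken by vertex number to make the ranking
    -- injective.
    κ : Fin n → ℕ
    κ w = key w * n + toℕ w

    κ-mono : key u < key v → κ u < κ v
    κ-mono {u} {v} lt = begin-strict
      key u * n + toℕ u   <⟨ +-monoʳ-< (key u * n) (Fin.toℕ<n u) ⟩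
      key u * n + n       ≡⟨ +-comm (key u * n) n ⟩
      suc (key u) * n     ≤⟨ *-monoˡ-≤ n lt ⟩
      key v * n           ≤⟨ m≤m+n (key v * n) (toℕ v) ⟩
      key v * n + toℕ v   ∎
      where open ≤-Reasoning

    κ-injective : κ u ≡ κ v → u ≡ v
    κ-injective {u} {v} eq with <-cmp (key u) (key v)
    ... | tri< lt _ _ = contradiction eq (<⇒≢ (κ-mono lt))
    ... | tri> _ _ gt = contradiction (≡-sym eq) (<⇒≢ (κ-mono gt))
    ... | tri≈ _ e _  = Fin.toℕ-injective
      (+-cancelˡ-≡ (key u * n) _ _ (trans eq (cong (λ x → x * n + toℕ v) (≡-sym e))))

    -- Directed distances along P and down from it

    open Rank G block triangle κ κ-injective

    excess-apex : ∀ {p q} → PEdge p q → Common p q w → a w ≡ a q × b w ≡ b p × excess w ≡ 1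
    excess-apex {w} {p} {q} e@(pedge p~q onp onq aq) (p~w , q~w) = aw , bw , excess-unique (begin
        a w + b w         ≡⟨ cong₂ _+_ aw bw ⟩
        a q + b p         ≡⟨ cong (_+ b p) aq ⟩
        suc (a p + b p)   ≡⟨ cong suc onp ⟩
        suc r             ≡⟨ +-comm 1 r ⟩
        r + 1             ∎)
      where
      open ≡-Reasoning
      aw : a w ≡ a q
      aw = apex block ρ p~q aq p~w q~w
      bw : b w ≡ b p
      bw = apex block σ (sym G p~q) (PEdge.b-suc e) q~w p~w

    key-P : OnP w → alt (a w) ≡ k → key w ≡ k
    key-P {w} on eq = trans (cong (λ e → key-of e (a w)) (excess-P on)) eq

    key-apex : ∀ {p q} → PEdge p q → Common p q w → key w ≡ 2
    key-apex {w} e c = cong (λ e → key-of e (a w)) (proj₂ (proj₂ (excess-apex e c)))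

    -- The ends of the edge have keys 0 and 1 in the order given by parity, and every other vertex
    -- of its block has key 2.
    P-top : ∀ {p q} → PEdge p q →
            (alt (a p) ≡ 0 × Top p q) ⊎ (alt (a p) ≡ 1 × Top q p)
    P-top {p} {q} e@(pedge p~q onp onq aq) with alt-suc (a p)
    ... | inj₁ (even , odd) = inj₁ (even , record
      { adjacent = p~q
      ; ordered  = κ-mono (subst₂ _<_ (≡-sym (key-P onp even))
                    (≡-sym (key-P onq (trans (cong alt aq) odd))) (s≤s z≤n))
      ; least-κ  = λ c → κ-mono (subst₂ _<_ (≡-sym (key-P onq (trans (cong alt aq) odd)))
                    (≡-sym (key-apex e c)) (s≤s (s≤s z≤n)))
      })
    ... | inj₂ (odd , even) = inj₂ (odd , record
      { adjacent = sym G p~q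
      ; ordered  = κ-mono (subst₂ _<_ (≡-sym (key-P onq (trans (cong alt aq) even)))
                    (≡-sym (key-P onp odd)) (s≤s z≤n))
      ; least-κ  = λ (q~w , p~w) → κ-mono (subst₂ _<_ (≡-sym (key-P onp odd))
                    (≡-sym (key-apex e (p~w , q~w))) (s≤s (s≤s z≤n)))
      })

    near-P-edge : ∀ {p q} → PEdge p q → Near p q 2
    near-P-edge e with P-top e
    ... | inj₁ (_ , top) = near-first-second top
    ... | inj₂ (_ , top) = near-sym (near-first-second top)

    -- Consecutive edges of P have opposite orientations, so in either direction one costs 1 and the
    -- other at most 2.
    near-P-two : ∀ {p q s} → PEdge p q → PEdge q s → Near p s 3
    near-P-two {p} {q} e e′ with P-top e | P-top e′
    ... | inj₁ (_ , t) | inj₂ (_ , t′) =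
      dist-cons (first→second t) (second⇝first t′) , dist-cons (first→second t′) (second⇝first t)
    ... | inj₂ (_ , t) | inj₁ (_ , t′) =
      distLe-trans (second⇝first t) (dist-arc (first→second t′)) ,
      distLe-trans (second⇝first t′) (dist-arc (first→second t))
    ... | inj₁ (z , _) | inj₁ (z′ , _) = contradiction
      (trans (≡-sym z′) (trans (cong alt (PEdge.a-suc e)) (cong (1 ∸_) z))) λ ()
    ... | inj₂ (z , _) | inj₂ (z′ , _) = contradiction
      (trans (≡-sym z′) (trans (cong alt (PEdge.a-suc e)) (cong (1 ∸_) z))) λ ()

    near-P : ∀ m {p q} → OnP p → OnP q → a q ≡ a p + m → Near p q (cost m)
    near-P m {p} {q} onp onq aq = go m onp onq aq (+-cancelˡ-≡ (a p) _ _ (begin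
        a p + b p          ≡⟨ trans onp (≡-sym onq) ⟩
        a q + b q          ≡⟨ cong (_+ b q) aq ⟩
        a p + m + b q      ≡⟨ +-assoc (a p) m (b q) ⟩
        a p + (m + b q)    ∎))
      where
      open ≡-Reasoning
      -- The equation for `b` guarantees that `P-next` can advance; edges are consumed in pairs,
      -- matching the recursion of `cost`.
      go : ∀ m {p q} → OnP p → OnP q → a q ≡ a p + m → b p ≡ m + b q → Near p q (cost m)
      go zero onp onq aq _
        with refl ← P-unique onp onq (≡-sym (trans aq (+-identityʳ _))) = near-refl
      go (suc zero) {p} onp onq aq bp with P-next onp bp
      ... | x , e , bx
        with refl ← P-unique (PEdge.onq e) onq (trans (PEdge.a-suc e) (≡-sym (trans aq (+-comm (a p) 1)))) =
        near-P-edge e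
      go (suc (suc m)) {p} onp onq aq bp with P-next onp bp
      ... | x , e , bx with P-next (PEdge.onq e) bx
      ... | y , e′ , by = near-trans (near-P-two e e′) (go m (PEdge.onq e′) onq ay by)
        where
        ay : a _ ≡ a y + m
        ay = begin
          _                  ≡⟨ aq ⟩
          a p + suc (suc m)  ≡⟨ trans (+-suc (a p) (suc m)) (cong suc (+-suc (a p) m)) ⟩
          suc (suc (a p)) + m  ≡⟨ cong (λ i → suc i + m) (PEdge.a-suc e) ⟨
          suc (a x) + m      ≡⟨ cong (_+ m) (PEdge.a-suc e′) ⟨
          a y + m            ∎

    -- By `apex`, all other vertices of the block are as far from `ρ` and from `σ` as `y`, so their
    -- excess is that of `g` plus 2. Hence `g` ranks first in the block.
    near-gate : ∀ {g} → Adj G g y → a y ≡ suc (a g) → b y ≡ suc (b g) → Near g y 2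
    near-gate {y} {g} g~y ay by = near-first g~y (above refl refl)
      (λ (g~w , y~w) → above (apex block ρ g~y ay g~w y~w) (apex block σ g~y by g~w y~w))
      where
      above : ∀ {w} → a w ≡ a y → b w ≡ b y → κ g < κ w
      above {w} aw bw = κ-mono (lower (excess g) ew)
        where
        open ≡-Reasoning
        ew : excess w ≡ suc (suc (excess g))
        ew = excess-unique (begin
          a w + b w                    ≡⟨ cong₂ _+_ (trans aw ay) (trans bw by) ⟩
          suc (a g) + suc (b g)        ≡⟨ cong suc (+-suc (a g) (b g)) ⟩
          suc (suc (a g + b g))        ≡⟨ cong (2 +_) (a+b≡r+excess g) ⟩
          suc (suc (r + excess g))     ≡⟨ cong suc (+-suc r (excess g)) ⟨
          suc (r + suc (excess g))     ≡⟨ +-suc r (suc (excess g)) ⟨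
          r + suc (suc (excess g))     ∎)

        alt≤1 : ∀ m → alt m ≤ 1
        alt≤1 zero    = z≤n
        alt≤1 (suc m) = m∸n≤m 1 (alt m)

        lower : ∀ e {d} → excess w ≡ suc (suc e) → key-of e d < key w
        lower zero {d} eq = subst (λ x → alt d < key-of x (a w)) (≡-sym eq) (s≤s (≤-trans (alt≤1 d) (s≤s z≤n)))
        lower (suc e)  eq = subst (λ x → 2 + e < key-of x (a w)) (≡-sym eq) (+-monoʳ-< 2 (n≤1+n (suc e)))

    -- Two vertices for each label 1 ≤ i ≤ r + t, together with ρ, show
    -- that n ≥ 2(r + t) + 1 whenever some vertex has depth t.
    depth : Fin n → ℕ
    depth w = ⌊ excess w /2⌋

    -- Vertices of depth 0 are labelled by their distance from `ρ`, which is at most `r`; positive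
    -- depths continue the numbering from `r + 1`.
    label-of : ℕ → ℕ → ℕ
    label-of zero    d = d
    label-of (suc i) _ = r + suc i

    label : Fin n → ℕ
    label w = label-of (depth w) (a w)

    label-excess≤1 : excess w ≤ 1 → label w ≡ a w
    label-excess≤1 {w} le = cong (λ i → label-of i (a w)) (n≤0⇒n≡0 (⌊n/2⌋-mono le))

    -- The upper bound on the labels ensures that a pair added with the next label is fresh.
    Pairs : ℕ → Set
    Pairs i = ∃[ L ] Unique L × length L ≡ suc (i * 2) × All (λ x → label x ≤ i) L

    pairs⇒≤ : ∀ {i} → Pairs i → suc (i * 2) ≤ n
    pairs⇒≤ (L , L! , len , _) = subst (_≤ n) len (unique⇒length≤ L!)

    add-pair : ∀ {i} → Pairs i → u ≢ v → label u ≡ suc i → label v ≡ suc i → Pairs (suc i)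
    add-pair {u} {v} {i} (L , L! , len , low) u≢v lu lv =
      u ∷ v ∷ L ,
      (u≢v ∷ All.map (fresh lu) low) ∷ All.map (fresh lv) low ∷ L! ,
      cong (2 +_) len ,
      ≤-reflexive lu ∷ ≤-reflexive lv ∷ All.map m≤n⇒m≤1+n low
      where
      fresh : label x ≡ suc i → label y ≤ i → x ≢ y
      fresh lx le refl = 1+n≰n (subst (_≤ i) lx le)

    on-ρ : OnP ρ
    on-ρ = cong₂ _+_ (dist-refl ρ) (dist-sym σ ρ)

    -- The next label is carried by the next vertex `q` of P and by the third vertex `w` of a
    -- triangle on the edge leading to it. The vertex of P at distance `i` is returned to continue
    -- from.
    P-pairs : ∀ i → i ≤ r → Pairs i × ∃[ p ] OnP p × a p ≡ i
    P-pairs zero _ = (ρ ∷ [] , [] ∷ [] , refl , ≤-reflexive lρ ∷ []) , ρ , on-ρ , dist-refl ρ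
      where
      lρ : label ρ ≡ 0
      lρ = trans (label-excess≤1 (≤-trans (≤-reflexive (excess-P on-ρ)) z≤n)) (dist-refl ρ)
    P-pairs (suc i) i<r with P-pairs i (<⇒≤ i<r)
    ... | pairs , p , on , refl = extend-P (b p) refl
      where
      extend-P : ∀ k → b p ≡ k → Pairs (suc (a p)) × ∃[ q ] OnP q × a q ≡ suc (a p)
      extend-P zero    bp = contradiction
        (trans (≡-sym (+-identityʳ (a p))) (trans (cong (a p +_) (≡-sym bp)) on)) (<⇒≢ i<r)
      extend-P (suc k) bp with P-next on bp
      ... | q , e@(pedge p~q _ onq aq) , _ with triangle p~q
      ... | w , c@(_ , q~w) with excess-apex e c
      ... | aw , _ , ew = add-pair pairs (λ { refl → irrefl G q~w })
          (trans (label-excess≤1 (≤-trans (≤-reflexive (excess-P onq)) z≤n)) aq)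
          (trans (label-excess≤1 (≤-reflexive ew)) (trans aw aq)) ,
        q , onq , aq

    -- The place where u is attached to P: a vertex of P if width is 0, and the
    -- vertex z in the block of the edge lo hi of P if width is 1.
    record Foot (u : Fin n) (t : ℕ) : Set where
      field
        lo hi   : Fin n
        width   : ℕ
        width≤1 : width ≤ 1
        on-lo   : OnP lo
        on-hi   : OnP hi
        a-hi    : a hi ≡ a lo + width
        a-u     : a u ≡ a hi + t
        b-u     : b u ≡ b lo + t
        near-lo : Near u lo (t + t + width * 2)
        near-hi : Near u hi (t + t + width * 2)
        base    : width ≡ 0 ⊎ (∃[ z ] PEdge lo hi × Common lo hi z × Near u z (t + t))

      -- Maximality of `r` enters here: replacing the part of P between `ρ` and `lo` by the branch
      -- to `u` cannot give a longer geodesic from `σ`.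
      t≤a-lo : t ≤ a lo
      t≤a-lo = +-cancelˡ-≤ (b lo) t (a lo) (begin
        b lo + t      ≡⟨ b-u ⟨
        b u           ≤⟨ longest σ u ⟩
        r             ≡⟨ on-lo ⟨
        a lo + b lo   ≡⟨ +-comm (a lo) (b lo) ⟩
        b lo + a lo   ∎)
        where open ≤-Reasoning

      t≤b-hi : t ≤ b hi
      t≤b-hi = +-cancelˡ-≤ (a hi) t (b hi) (begin
        a hi + t      ≡⟨ a-u ⟨
        a u           ≤⟨ longest ρ u ⟩
        r             ≡⟨ on-hi ⟨
        a hi + b hi   ∎)
        where open ≤-Reasoning

      excess-u : excess u ≡ width + (t + t)
      excess-u = excess-unique (begin
        a u + b u                              ≡⟨ cong₂ _+_ (trans a-u (cong (_+ t) a-hi)) b-u ⟩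
        a lo + width + t + (b lo + t)          ≡⟨ rearrange (a lo) width t (b lo) ⟩
        a lo + b lo + (width + (t + t))        ≡⟨ cong (_+ (width + (t + t))) on-lo ⟩
        r + (width + (t + t))                  ∎)
        where
        open ≡-Reasoning
        rearrange : ∀ x y t z → x + y + t + (z + t) ≡ x + z + (y + (t + t))
        rearrange = solve-∀

      depth-u : depth u ≡ t
      depth-u = trans (cong ⌊_/2⌋ excess-u) (halve width≤1)
        where
        halve : ∀ {y} → y ≤ 1 → ⌊ y + (t + t) /2⌋ ≡ t
        halve z≤n       = ≡-sym (n≡⌊n+n/2⌋ t)
        -- The floor of half of `1 + (t + t)` is by definition the ceiling of half of `t + t`.
        halve (s≤s z≤n) = ≡-sym (n≡⌈n+n/2⌉ t)

    foot-on : OnP u → Foot u 0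
    foot-on {u} on = record
      { lo = u ; hi = u ; width = 0 ; width≤1 = z≤n ; on-lo = on ; on-hi = on
      ; a-hi = ≡-sym (+-identityʳ _) ; a-u = ≡-sym (+-identityʳ _) ; b-u = ≡-sym (+-identityʳ _)
      ; near-lo = near-refl ; near-hi = near-refl ; base = inj₁ refl }

    near-apex : ∀ {p q} → PEdge p q → Common p q w → Near w p 2 × Near w q 2
    near-apex e (p~w , q~w) with P-top e
    ... | inj₁ (_ , top) =
      near-sym (near-first-other top (p~w , q~w)) , near-sym (near-second-other top (p~w , q~w))
    ... | inj₂ (_ , top) =
      near-sym (near-second-other top (q~w , p~w)) , near-sym (near-first-other top (q~w , p~w))

    near-apices : ∀ {p q} → PEdge p q → Common p q v → Common p q w → Near v w 3
    near-apices e (p~v , q~v) (p~w , q~w) with P-top e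
    ... | inj₁ (_ , top) = near-others top (p~v , q~v) (p~w , q~w)
    ... | inj₂ (_ , top) = near-others top (q~v , p~v) (q~w , p~w)

    foot-inside : ∀ {p q} → PEdge p q → Common p q u → a u ≡ a q → b u ≡ b p → Foot u 0
    foot-inside {u} {p} {q} e c au bu = record
      { lo = p ; hi = q ; width = 1 ; width≤1 = ≤-refl
      ; on-lo = PEdge.onp e ; on-hi = PEdge.onq e
      ; a-hi = trans (PEdge.a-suc e) (+-comm 1 (a p))
      ; a-u = trans au (≡-sym (+-identityʳ _)) ; b-u = trans bu (≡-sym (+-identityʳ _))
      ; near-lo = proj₁ (near-apex e c) ; near-hi = proj₂ (near-apex e c)
      ; base = inj₂ (u , e , c , near-refl) }

    foot-below : ∀ {g t} → Near g u 2 → a u ≡ suc (a g) → b u ≡ suc (b g) → Foot g t → Foot u (suc t)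
    foot-below {u} {g} {t} near au bu F = record
      { lo = lo ; hi = hi ; width = width ; width≤1 = width≤1 ; on-lo = on-lo ; on-hi = on-hi
      ; a-hi = a-hi
      ; a-u = trans au (trans (cong suc a-u) (≡-sym (+-suc (a hi) t)))
      ; b-u = trans bu (trans (cong suc b-u) (≡-sym (+-suc (b lo) t)))
      ; near-lo = lift (t + t + width * 2) (cong (_+ width * 2) double) near-lo
      ; near-hi = lift (t + t + width * 2) (cong (_+ width * 2) double) near-hi
      ; base = Sum.map₂ (λ (z , e , c , near-z) → z , e , c , lift (t + t) double near-z) base }
      where
      open Foot F
      double : suc (suc (t + t)) ≡ suc t + suc t
      double = cong suc (≡-sym (+-suc t t))
      lift : ∀ {x k} j → 2 + j ≡ k → Near g x j → Near u x k
      lift j eq near′ = near-mono (≤-reflexive eq) (near-trans (near-sym near) near′)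

    -- Induction on the distance from `ρ`. Below a gate `g`, the foot of `g` is inherited with depth
    -- one more, and `u` together with a third vertex `w` of the block supplies the pair with the
    -- new label.
    foot : ∀ u → ∃[ t ] Foot u t × Pairs (r + t)
    foot u = go (a u) u refl
      where
      pairs₀ : Pairs (r + 0)
      pairs₀ = subst Pairs (≡-sym (+-identityʳ r)) (proj₁ (P-pairs r ≤-refl))

      go : ∀ k u → a u ≡ k → ∃[ t ] Foot u t × Pairs (r + t)
      go k u eq with a u + b u ≟ r
      ... | yes on = 0 , foot-on on , pairs₀
      ... | no off with hang u off
      ... | inside e p~u q~u au bu = 0 , foot-inside e (p~u , q~u) au bu , pairs₀
      go zero u eq | no off | below g~u au bu = contradiction (trans (≡-sym eq) au) λ ()
      go (suc k) u eq | no off | below {g} g~u au bu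
        with go k g (suc-injective (trans (≡-sym au) eq)) | triangle g~u
      ... | t , F , pairs | w , g~w , u~w =
        suc t , F′ , subst Pairs (≡-sym (+-suc r t))
          (add-pair pairs (λ { refl → irrefl G u~w }) (label-at (Foot.depth-u F′))
            (label-at (trans (cong ⌊_/2⌋ same) (Foot.depth-u F′))))
        where
        F′ : Foot u (suc t)
        F′ = foot-below (near-gate g~u au bu) au bu F

        same : excess w ≡ excess u
        same = cong₂ (λ i j → i + j ∸ r) (apex block ρ g~u au g~w u~w) (apex block σ g~u bu g~w u~w)

        label-at : ∀ {x} → depth x ≡ suc t → label x ≡ suc (r + t)
        label-at {x} eq = trans (cong (λ i → label-of i (a x)) eq) (+-suc r t)

    -- Distance between two vertices by way of their feet

    Bounded : Fin n → Fin n → ℕ → ℕ → Set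
    Bounded u v t₁ t₂ = ∃[ k ] Near u v k × 2 * k ≤ 3 * r + (t₁ + t₂) + 3

    module _ {t₁ t₂ : ℕ} (F : Foot u t₁) (F′ : Foot v t₂) where
      private
        module F = Foot F
        module F′ = Foot F′

      bounded-separated : a F.hi ≤ a F′.lo → Bounded u v t₁ t₂
      bounded-separated le with m≤n⇒∃[o]m+o≡n le
      ... | m , eq =
        t₁ + t₁ + e + (t₂ + t₂) ,
        near-mono (≤-reflexive (regroup t₁ t₂ F.width F′.width (cost m)))
          (near-trans F.near-hi
            (near-trans (near-P m F.on-hi F′.on-lo (≡-sym eq)) (near-sym F′.near-lo))) ,
        total-cost t₁ t₂ (F.width + m + F′.width) e r r≥ (separated-cost m F.width≤1 F′.width≤1)
        where
        open ≤-Reasoning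
        e = F.width * 2 + cost m + F′.width * 2

        regroup : ∀ t₁ t₂ x y c → t₁ + t₁ + x * 2 + (c + (t₂ + t₂ + y * 2)) ≡
                  t₁ + t₁ + (x * 2 + c + y * 2) + (t₂ + t₂)
        regroup = solve-∀

        assoc : ∀ i x m y j → i + (x + m + y) + j ≡ i + x + m + y + j
        assoc = solve-∀

        r≥ : t₁ + (F.width + m + F′.width) + t₂ ≤ r
        r≥ = begin
          t₁ + (F.width + m + F′.width) + t₂                ≤⟨ +-mono-≤ (+-monoˡ-≤ _ F.t≤a-lo) F′.t≤b-hi ⟩
          a F.lo + (F.width + m + F′.width) + b F′.hi       ≡⟨ assoc (a F.lo) F.width m F′.width (b F′.hi) ⟩
          a F.lo + F.width + m + F′.width + b F′.hi         ≡⟨ cong (λ i → i + m + F′.width + b F′.hi) F.a-hi ⟨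
          a F.hi + m + F′.width + b F′.hi                   ≡⟨ cong (λ i → i + F′.width + b F′.hi) eq ⟩
          a F′.lo + F′.width + b F′.hi                      ≡⟨ cong (_+ b F′.hi) F′.a-hi ⟨
          a F′.hi + b F′.hi                                 ≡⟨ F′.on-hi ⟩
          r                                                 ∎

      -- Both vertices hang in the block of the same edge of P. Passing directly between the
      -- attachment vertices `z` and `z′` costs 3, whereas the separate estimates through an end of
      -- that edge would add up to 4.
      bounded-same : a F.lo ≡ a F′.lo → F.width ≢ 0 → F′.width ≢ 0 → Bounded u v t₁ t₂
      bounded-same eq x≢0 y≢0 with F.base | F′.base
      ... | inj₁ x≡0 | _        = contradiction x≡0 x≢0
      ... | inj₂ _   | inj₁ y≡0 = contradiction y≡0 y≢0
      ... | inj₂ (z , e , c , near-z) | inj₂ (z′ , e′ , c′ , near-z′) =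
        t₁ + t₁ + 3 + (t₂ + t₂) ,
        near-trans (near-trans near-z (near-apices e c c″)) (near-sym near-z′) ,
        -- The shared edge counts as a stretch of length 1 with cost 3, which meets the requirement
        -- `2 * e ≤ 3 * m + 3` with equality.
        total-cost t₁ t₂ 1 3 r r≥ ≤-refl
        where
        open ≤-Reasoning
        a-hi≡ : a F.hi ≡ a F′.hi
        a-hi≡ = trans (PEdge.a-suc e) (trans (cong suc eq) (≡-sym (PEdge.a-suc e′)))

        c″ : Common F.lo F.hi z′
        c″ = subst₂ (λ p q → Common p q z′) (P-unique F′.on-lo F.on-lo (≡-sym eq))
          (P-unique F′.on-hi F.on-hi (≡-sym a-hi≡)) c′

        r≥ : t₁ + 1 + t₂ ≤ r
        r≥ = begin
          t₁ + 1 + t₂            ≤⟨ +-mono-≤ (+-monoˡ-≤ 1 F.t≤a-lo) F′.t≤b-hi ⟩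
          a F.lo + 1 + b F′.hi   ≡⟨ cong (_+ b F′.hi) (+-comm (a F.lo) 1) ⟩
          suc (a F.lo) + b F′.hi ≡⟨ cong (_+ b F′.hi) (trans (≡-sym (PEdge.a-suc e)) a-hi≡) ⟩
          a F′.hi + b F′.hi      ≡⟨ F′.on-hi ⟩
          r                      ∎

    -- The feet occupy intervals of length at most 1 on P. Unless one ends no later than the other
    -- begins, they are the same unit interval.
    bounded : ∀ {t₁ t₂} → Foot u t₁ → Foot v t₂ → Bounded u v t₁ t₂
    bounded {u} {v} {t₁} {t₂} F F′ =
      cases (a (Foot.hi F) ≤? a (Foot.lo F′)) (a (Foot.hi F′) ≤? a (Foot.lo F))
      where
      collapse : ∀ {x t} (H : Foot x t) → Foot.width H ≡ 0 → a (Foot.hi H) ≤ a (Foot.lo H)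
      collapse H w≡0 = ≤-reflexive (trans (Foot.a-hi H)
        (trans (cong (a (Foot.lo H) +_) w≡0) (+-identityʳ _)))

      below-hi : ∀ {x t i} (H : Foot x t) → ¬ (a (Foot.hi H) ≤ i) → i ≤ a (Foot.lo H)
      below-hi {i = i} H ≰ = ≤-pred (begin
        suc i                              ≤⟨ ≰⇒> ≰ ⟩
        a (Foot.hi H)                      ≡⟨ Foot.a-hi H ⟩
        a (Foot.lo H) + Foot.width H       ≤⟨ +-monoʳ-≤ (a (Foot.lo H)) (Foot.width≤1 H) ⟩
        a (Foot.lo H) + 1                  ≡⟨ +-comm (a (Foot.lo H)) 1 ⟩
        suc (a (Foot.lo H))                ∎)
        where open ≤-Reasoning

      cases : Dec (a (Foot.hi F) ≤ a (Foot.lo F′)) → Dec (a (Foot.hi F′) ≤ a (Foot.lo F)) →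
              Bounded u v t₁ t₂
      cases (yes le) _ = bounded-separated F F′ le
      cases (no _) (yes le) with k , near , le′ ← bounded-separated F′ F le =
        k , near-sym near , subst (λ t → 2 * k ≤ 3 * r + t + 3) (+-comm t₂ t₁) le′
      cases (no ≰) (no ≰′) = bounded-same F F′ (≤-antisym lo≤ lo′≤)
          (λ w≡0 → ≰ (≤-trans (collapse F w≡0) lo≤)) (λ w≡0 → ≰′ (≤-trans (collapse F′ w≡0) lo′≤))
        where
        lo≤ : a (Foot.lo F) ≤ a (Foot.lo F′)
        lo≤ = below-hi F′ ≰′

        lo′≤ : a (Foot.lo F′) ≤ a (Foot.lo F)
        lo′≤ = below-hi F ≰

    oriented-diameter : OrientedDiamLe G (bound n)
    oriented-diameter = orient , λ u v →
      let t₁ , F , pairs = foot u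
          t₂ , F′ , pairs′ = foot v
          k , near , 2k≤ = bounded F F′
      in proj₁ (near-mono (≤-bound₂ r t₁ t₂ k (pairs⇒≤ pairs) (pairs⇒≤ pairs′) 2k≤) near)

theorem2 : (n : ℕ) (G : Graph n) → Bridgeless G → BlockGraph G → OrientedDiamLe G (bound n)
-- With no vertices there is no diametral pair to choose, and the empty orientation suffices.
theorem2 zero G _ _ =
  record { Arc = λ () ; arc-edge = λ { {()} } ; total = λ { {()} } ; antisym = λ { {()} } } , λ ()
theorem2 (suc n) G bridgeless@(connected , _) block
  with ρ , σ , longest ← Distance.diametral G connected zero =
  Frame.oriented-diameter G connected block (edge-in-triangle G bridgeless block) ρ σ longest
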